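{- Let $G$ be a finite simple connected graph of girth $g$ and cycle rank $\beta=|E(G)|-|V(G)|+1$. Fix any total ordering of $E(G)$, and let $h_G(z)=\sum_j h_j z^j$ be the $h$-polynomial of the broken-circuit complex $\mathrm{BC}(G)$. Then $$h_j=\binom{\beta+j-1}{j}\qquad(0\le j\le g-2).$$ If $c_g(G)$ denotes the number of simple cycles of length $g$ in $G$, then $$h_{g-1}=\binom{\beta+g-2}{g-1}-c_g(G).$$
   Context: The girth $g$ is the length of a shortest cycle of $G$ (so $G$ contains a cycle). Simple cycles are counted as subgraphs. For a finite connected loopless graph $G$ with a fixed total order on $E(G)$, a broken circuit is a set $C\setminus\{\max C\}$, where $C$ is the edge set of a cycle of $G$ and $\max C$ is its largest edge. The broken-circuit complex $\mathrm{BC}(G)$ is the simplicial complex on $E(G)$ whose faces are the edge sets containing no broken circuit. With $r=|V(G)|-1$ and $b_i$ the number of faces of $\mathrm{BC}(G)$ having exactly $i$ elements, the $h$-polynomial of $\mathrm{BC}(G)$ is $h_G(z)=\sum_{i=0}^{r}b_i z^i(1-z)^{r-i}$. -}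

module Defs where

open import Data.Fin using (Fin; toℕ; fromℕ<)
open import Data.Fin.Properties using (_≟_; any?; all?; injective⇒≤; toℕ<n; toℕ-fromℕ<)
open import Data.Fin.Subset using (Subset; inside; outside; _∈_; _⊆_; _-_; ∣_∣)
open import Data.Fin.Subset.Properties using (_∈?_; _⊆?_; anySubset?)
open import Data.Integer using (ℤ; +_; 0ℤ; 1ℤ; -1ℤ)
import Data.Integer as ℤ
open import Data.List using (List; []; _∷_; _++_; map; filter; length; foldr; upTo)
open import Data.Nat using (ℕ; zero; suc; _+_; _∸_; _≤_; s≤s)
import Data.Nat.Properties as ℕ
open import Data.Nat.DivMod using (_mod_)
open import Data.Product using (_×_; _,_; ∃; ∃-syntax)
open import Data.Product.Properties using (≡-dec)
open import Data.Sum using (_⊎_)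
open import Data.Vec using (Vec; []; _∷_; lookup)
open import Data.Vec.Properties using () renaming (≡-dec to ≡-decᵛ)
open import Data.Bool.Properties using () renaming (_≟_ to _≟ᵇ_)
open import Function.Bundles using (_⇔_; mk⇔; Equivalence)
open import Function.Definitions using (Injective)
open import Level using (Level; _⊔_)
open import Relation.Binary.Construct.Closure.ReflexiveTransitive using (Star)
open import Relation.Binary.Consequences using (total∧dec⇒dec)
open import Relation.Binary.Core using (Rel)
open import Relation.Binary.Definitions using () renaming (Decidable to Decidable₂)
open import Relation.Binary.PropositionalEquality using (_≡_)
open import Relation.Binary.Structures using (IsTotalOrder)
open import Relation.Nullary using (¬_; Dec)
open import Relation.Nullary.Decidable using (map′; _×-dec_; _⊎-dec_; _→-dec_; ¬?)
open import Relation.Unary using (Pred; Decidable)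

private
  variable
    a b p ℓ : Level
    k n m : ℕ

------------------------------------------------------------------------
-- Finite simple graphs

-- The pair `ends e` is only a listing of the two endpoints of e in some
-- order; everything below uses it through the symmetric relation Joins.
record Graph : Set where
  field
    order : ℕ
    size  : ℕ

  Vertex : Set
  Vertex = Fin order

  Edge : Set
  Edge = Fin size

  field
    ends : Edge → Vertex × Vertex

  Joins : Edge → Vertex → Vertex → Set
  Joins e u v = ends e ≡ (u , v) ⊎ ends e ≡ (v , u)

  field
    loopless   : ∀ e v → ¬ Joins e v v
    noMultiple : ∀ {e f u v} → Joins e u v → Joins f u v → e ≡ f

  Adjacent : Vertex → Vertex → Set
  Adjacent u v = ∃[ e ] Joins e u v

  EdgeSet : Set
  EdgeSet = Subset size

open Graph public using (Edge; EdgeSet)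

Connected : Graph → Set
Connected G = ∀ u v → Star Adjacent u v
  where open Graph G

-- For connected G, order ≤ size + 1, so the truncated subtraction is exact.
cycleRank : Graph → ℕ
cycleRank G = size + 1 ∸ order
  where open Graph G

------------------------------------------------------------------------
-- Cycles

next : Fin (3 + k) → Fin (3 + k)
next {k} i = suc (toℕ i) mod (3 + k)

-- C is the edge set of the cycle v₀ v₁ … v₂₊ₖ v₀.
record CycleThrough (G : Graph) (v : Vec (Graph.Vertex G) (3 + k))
                    (C : EdgeSet G) : Set where
  open Graph G
  field
    distinct : Injective _≡_ _≡_ (lookup v)
    adjacent : ∀ i → Adjacent (lookup v i) (lookup v (next i))
    edges    : ∀ e → e ∈ C ⇔ (∃[ i ] Joins e (lookup v i) (lookup v (next i)))

-- A cycle has no isolated vertices, so as a subgraph it is determined by its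
-- edge set C, and its length is ∣ C ∣.
IsCycle : (G : Graph) → EdgeSet G → Set
IsCycle G C = ∃[ k ] ∃[ v ] CycleThrough {k} G v C

IsGirth : Graph → ℕ → Set
IsGirth G g = (∃[ C ] (IsCycle G C × ∣ C ∣ ≡ g))
            × (∀ C → IsCycle G C → g ≤ ∣ C ∣)

------------------------------------------------------------------------
-- The broken-circuit complex, for an order _≼_ on the edges

IsMax : (G : Graph) → Rel (Edge G) ℓ → Edge G → EdgeSet G → Set ℓ
IsMax G _≼_ e C = e ∈ C × (∀ f → f ∈ C → f ≼ e)

IsBrokenCircuit : (G : Graph) → Rel (Edge G) ℓ → EdgeSet G → Set ℓ
IsBrokenCircuit G _≼_ B =
  ∃[ C ] (IsCycle G C × ∃[ e ] (IsMax G _≼_ e C × B ≡ C - e))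

IsFace : (G : Graph) → Rel (Edge G) ℓ → EdgeSet G → Set ℓ
IsFace G _≼_ S = ¬ (∃[ B ] (IsBrokenCircuit G _≼_ B × B ⊆ S))

------------------------------------------------------------------------
-- Decidability, needed in order to count

_⇔-dec_ : {A : Set a} {B : Set b} → Dec A → Dec B → Dec (A ⇔ B)
a? ⇔-dec b? = map′ (λ (f , g) → mk⇔ f g)
                   (λ e → Equivalence.to e , Equivalence.from e)
                   ((a? →-dec b?) ×-dec (b? →-dec a?))

anyVec? : ∀ k {P : Pred (Vec (Fin n) k) p} → Decidable P → Dec (∃ P)
anyVec? zero    P? = map′ (λ q → [] , q) (λ { ([] , q) → q }) (P? [])
anyVec? (suc k) P? = map′ (λ (x , xs , q) → x ∷ xs , q)
                          (λ { (x ∷ xs , q) → x , xs , q })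
                          (any? λ x → anyVec? k λ xs → P? (x ∷ xs))

joins? : ∀ G e u v → Dec (Graph.Joins G e u v)
joins? G e u v = (ends e ≟² (u , v)) ⊎-dec (ends e ≟² (v , u))
  where open Graph G
        _≟²_ = ≡-dec _≟_ _≟_

cycleThrough? : ∀ G (v : Vec (Graph.Vertex G) (3 + k)) C → Dec (CycleThrough G v C)
cycleThrough? G v C = map′
  (λ (d , a , e) → record { distinct = λ {i} {j} → d i j ; adjacent = a ; edges = e })
  (λ c → (λ _ _ → CycleThrough.distinct c) , CycleThrough.adjacent c , CycleThrough.edges c)
  ((all? λ i → all? λ j → (lookup v i ≟ lookup v j) →-dec (i ≟ j))
   ×-dec (all? λ i → any? λ e → joins? G e (lookup v i) (lookup v (next i)))
   ×-dec (all? λ e → (e ∈? C) ⇔-dec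
                     (any? λ i → joins? G e (lookup v i) (lookup v (next i)))))

-- A cycle has at most as many vertices as G, which bounds the search.
isCycle? : ∀ G → Decidable (IsCycle G)
isCycle? G C = map′ (λ (k , c) → toℕ k , c) bounded
                    (any? {order} λ k → anyVec? (3 + toℕ k) λ v → cycleThrough? G v C)
  where
  open Graph G
  bounded : IsCycle G C → ∃[ k ] ∃[ v ] CycleThrough {toℕ {order} k} G v C
  bounded (k , c@(_ , t)) = fromℕ< k<n , transport c
    where
    k<n : suc k ≤ order
    k<n = ℕ.≤-trans (s≤s (ℕ.m≤n+m k 2)) (injective⇒≤ (CycleThrough.distinct t))
    transport : (∃[ v ] CycleThrough {k} G v C) →
                ∃[ v ] CycleThrough {toℕ (fromℕ< k<n)} G v C
    transport rewrite toℕ-fromℕ< k<n = λ c → c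

module _ (G : Graph) {_≼_ : Rel (Edge G) ℓ} (≼-total : IsTotalOrder _≡_ _≼_) where

  open IsTotalOrder ≼-total

  ≼-dec : Decidable₂ _≼_
  ≼-dec = total∧dec⇒dec reflexive antisym total _≟_

  isBrokenCircuit? : Decidable (IsBrokenCircuit G _≼_)
  isBrokenCircuit? B = anySubset? λ C → isCycle? G C ×-dec (any? λ e →
    ((e ∈? C) ×-dec (all? λ f → (f ∈? C) →-dec ≼-dec f e))
    ×-dec ≡-decᵛ _≟ᵇ_ B (C - e))

  isFace? : Decidable (IsFace G _≼_)
  isFace? S = ¬? (anySubset? λ B → isBrokenCircuit? B ×-dec (B ⊆? S))

------------------------------------------------------------------------
-- Counting

subsets : ∀ n → List (Subset n)
subsets zero    = [] ∷ []
subsets (suc n) = map (outside ∷_) (subsets n) ++ map (inside ∷_) (subsets n)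

count : {P : Pred (Subset n) p} → Decidable P → ℕ
count P? = length (filter P? (subsets _))

cycleCount : Graph → ℕ → ℕ
cycleCount G l = count (λ C → isCycle? G C ×-dec (∣ C ∣ ℕ.≟ l))

faceCount : (G : Graph) {_≼_ : Rel (Edge G) ℓ} → IsTotalOrder _≡_ _≼_ → ℕ → ℕ
faceCount G ≼-total i = count (λ S → isFace? G ≼-total S ×-dec (∣ S ∣ ℕ.≟ i))

------------------------------------------------------------------------
-- Integer polynomials, as lists of coefficients in increasing degree

Poly : Set
Poly = List ℤ

coeff : Poly → ℕ → ℤ
coeff []       _       = 0ℤ
coeff (c ∷ _)  zero    = c
coeff (_ ∷ cs) (suc j) = coeff cs j

infixl 6 _⊕_
infixl 7 _⊗_
infixr 7 _·_
infixr 8 _↑_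

_⊕_ : Poly → Poly → Poly
[]       ⊕ q        = q
(c ∷ cs) ⊕ []       = c ∷ cs
(c ∷ cs) ⊕ (d ∷ ds) = (c ℤ.+ d) ∷ (cs ⊕ ds)

_·_ : ℤ → Poly → Poly
c · q = map (c ℤ.*_) q

_⊗_ : Poly → Poly → Poly
[]       ⊗ q = []
(c ∷ cs) ⊗ q = (c · q) ⊕ (0ℤ ∷ (cs ⊗ q))

_↑_ : Poly → ℕ → Poly
q ↑ zero  = 1ℤ ∷ []
q ↑ suc i = q ⊗ (q ↑ i)

Z 1-Z : Poly
Z   = 0ℤ ∷ 1ℤ ∷ []
1-Z = 1ℤ ∷ -1ℤ ∷ []

-- Σ≤ r f = f 0 ⊕ f 1 ⊕ … ⊕ f r
Σ≤ : ℕ → (ℕ → Poly) → Poly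
Σ≤ r f = foldr _⊕_ [] (map f (upTo (suc r)))

hPoly : (G : Graph) {_≼_ : Rel (Edge G) ℓ} → IsTotalOrder _≡_ _≼_ → Poly
hPoly G ≼-total = Σ≤ r λ i → (+ faceCount G ≼-total i) · (Z ↑ i ⊗ 1-Z ↑ (r ∸ i))
  where r = Graph.order G ∸ 1

{-# OPTIONS --safe #-}
module Submission where

-- By minimality of the girth a nonface has at least g - 1 elements, and one with
-- exactly g - 1 elements is C ∖ max C for a cycle C of length g. The cycle is
-- recovered from it: the endpoints of max C are the vertices of degree one in
-- the path C ∖ max C, and G is simple. So b_i = C(n, i) for i < g - 1 and
-- b_{g-1} = C(n, g-1) - c_g, where n = |E|. If b_i were C(n, i) for every i,
-- then h(z) would agree with (1 - z)^{-β} up to degree r, and the defect c_g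
-- enters the coefficients up to degree g - 1 only as the term -c_g z^{g-1}.

open import Defs
import Data.Empty as Empty
open import Data.Fin using (Fin; zero; suc; toℕ; inject₁; fromℕ)
open import Data.Fin.Properties
  using (_≟_; injective⇒≤; toℕ-injective; toℕ<n; toℕ-fromℕ<; toℕ-fromℕ; toℕ-inject₁; ¬∀⟶∃¬)
open import Data.Fin.Subset
  using (Subset; inside; outside; _∈_; _∉_; _⊆_; ∣_∣; ⁅_⁆; _∪_; ⊥; ⊤; Nonempty; Empty)
  renaming (_-_ to _∖_)
open import Data.Fin.Subset.Properties
  using (_∈?_; _⊆?_; anySubset?; nonempty?; ⊆-antisym; ⊆-refl; p⊆q⇒∣p∣≤∣q∣; p⊂q⇒∣p∣<∣q∣; p─q⊆p; p─⊥≡p;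
         x∈p∧x≢y⇒x∈p-y; x∈⁅x⁆; x∈⁅y⁆⇒x≡y; x∈p∪q⁻; p⊆p∪q; q⊆p∪q; ∉⊥; Empty-unique;
         ∣p∣≤n; ∣⁅x⁆∣≡1; ∣⊥∣≡0; ∣⊤∣≡n; drop-there)
open import Data.Integer using (ℤ; +_; 0ℤ; 1ℤ; -1ℤ; _-_)
  renaming (_+_ to _+ᶻ_; _*_ to _*ᶻ_; -_ to -ᶻ_)
import Data.Integer.Properties as ℤ
open import Data.Integer.Solver using (module +-*-Solver)
open import Data.List using (List; []; _∷_; _∷ʳ_; _++_; map; filter; length; lookup; foldr; upTo)
open import Data.List.Membership.Propositional using () renaming (_∈_ to _∈ˡ_)
open import Data.List.Membership.Propositional.Properties
  using (∈-map⁺; ∈-map⁻; ∈-++⁺ˡ; ∈-++⁺ʳ; ∈-filter⁺; ∈-filter⁻; ∈-lookup)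
import Data.List.Membership.Setoid.Properties as Membership
open import Data.List.Properties using (length-++; length-map; filter-++; filter-≐; filter-none; upTo-∷ʳ)
import Data.List.Relation.Unary.All as All
open import Data.List.Relation.Unary.Any using (here; index)
open import Data.List.Relation.Unary.Unique.Propositional using (Unique; []; _∷_)
import Data.List.Relation.Unary.Unique.Propositional.Properties as Unique
open import Data.Nat using (ℕ; zero; suc; _+_; _∸_; _≤_; _<_; z≤n; s≤s)
open import Data.Nat.Combinatorics using (_C_; nCk+nC[k+1]≡[n+1]C[k+1])
open import Data.Nat.DivMod using (_%_; m<n⇒m%n≡m; n%n≡0; m%n<n)
import Data.Nat.Properties as ℕ
open import Data.Product using (_×_; _,_; proj₁; proj₂; ∃-syntax)
open import Data.Product.Properties using (,-injective)
open import Data.Sum using (_⊎_; inj₁; inj₂; swap; reduce)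
open import Data.Vec using (Vec; []; _∷_; here; there) renaming (lookup to lookupᵛ)
open import Data.Vec.Properties using (∷-injectiveʳ)
open import Function using (_∘_)
open import Function.Bundles using (Equivalence)
open import Level using (Level)
open import Relation.Binary.Construct.Closure.ReflexiveTransitive using (Star; ε; _◅_)
open import Relation.Binary.Core using (Rel)
open import Relation.Binary.Definitions using (Total; Transitive)
open import Relation.Binary.PropositionalEquality
  using (_≡_; _≢_; _≗_; refl; sym; trans; cong; cong₂; subst; setoid; module ≡-Reasoning)
open import Relation.Binary.Structures using (IsTotalOrder)
open import Relation.Nullary using (¬_; yes; no; contradiction)
open import Relation.Nullary.Decidable using (_×-dec_; ¬?; decidable-stable)
open import Relation.Unary using (Pred; Decidable)

private
  variable
    a ℓ p q : Level
    A B : Set a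
    k m n : ℕ

-- Coefficients of the h-polynomial

coeff-⊕ : ∀ p q j → coeff (p ⊕ q) j ≡ coeff p j +ᶻ coeff q j
coeff-⊕ []       q        j       = sym (ℤ.+-identityˡ _)
coeff-⊕ (c ∷ cs) []       j       = sym (ℤ.+-identityʳ _)
coeff-⊕ (c ∷ cs) (d ∷ ds) zero    = refl
coeff-⊕ (c ∷ cs) (d ∷ ds) (suc j) = coeff-⊕ cs ds j

coeff-· : ∀ c p j → coeff (c · p) j ≡ c *ᶻ coeff p j
coeff-· c []       j       = sym (ℤ.*-zeroʳ c)
coeff-· c (d ∷ ds) zero    = refl
coeff-· c (d ∷ ds) (suc j) = coeff-· c ds j

shift : (ℕ → ℤ) → ℕ → ℤ
shift a zero    = 0ℤ
shift a (suc j) = a j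

shift-0 : ∀ j → shift (coeff []) j ≡ 0ℤ
shift-0 zero    = refl
shift-0 (suc j) = refl

-- Multiplication by 1 - z on coefficient sequences, as `shift` is multiplication by z. Polynomials
-- are compared through `coeff` because lists that differ in trailing zeros represent the same
-- polynomial.
Δ : (ℕ → ℤ) → ℕ → ℤ
Δ a j = a j - shift a j

shift-cong : ∀ {a b} → a ≗ b → shift a ≗ shift b
shift-cong eq zero    = refl
shift-cong eq (suc j) = eq j

Δ-cong : ∀ {a b} → a ≗ b → Δ a ≗ Δ b
Δ-cong eq j = cong₂ _-_ (eq j) (shift-cong eq j)

Δ-shift : ∀ a → Δ (shift a) ≗ shift (Δ a)
Δ-shift a zero    = refl
Δ-shift a (suc j) = refl

coeff-0∷ : ∀ p → coeff (0ℤ ∷ p) ≗ shift (coeff p)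
coeff-0∷ p zero    = refl
coeff-0∷ p (suc j) = refl

coeff-∷⊗ : ∀ c p q j → coeff ((c ∷ p) ⊗ q) j ≡ c *ᶻ coeff q j +ᶻ shift (coeff (p ⊗ q)) j
coeff-∷⊗ c p q j = trans (coeff-⊕ (c · q) (0ℤ ∷ p ⊗ q) j)
                         (cong₂ _+ᶻ_ (coeff-· c q j) (coeff-0∷ (p ⊗ q) j))

-- Every list of zeros represents the zero polynomial. This serves the cases of `⊗-congˡ` in which
-- one list ends before the other.
coeff-[]⊗ : ∀ p q → coeff p ≗ coeff [] → coeff (p ⊗ q) ≗ coeff []
coeff-[]⊗ []      q eq j = refl
coeff-[]⊗ (c ∷ p) q eq j = begin
  coeff ((c ∷ p) ⊗ q) j
    ≡⟨ coeff-∷⊗ c p q j ⟩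
  c *ᶻ coeff q j +ᶻ shift (coeff (p ⊗ q)) j
    ≡⟨ cong₂ _+ᶻ_ (cong (_*ᶻ coeff q j) (eq 0)) (shift-cong (coeff-[]⊗ p q (eq ∘ suc)) j) ⟩
  0ℤ *ᶻ coeff q j +ᶻ shift (coeff []) j
    ≡⟨ cong₂ _+ᶻ_ (ℤ.*-zeroˡ (coeff q j)) (shift-0 j) ⟩
  0ℤ ∎
  where open ≡-Reasoning

⊗-congˡ : ∀ p p′ q → coeff p ≗ coeff p′ → coeff (p ⊗ q) ≗ coeff (p′ ⊗ q)
⊗-congˡ []      p′        q eq j = sym (coeff-[]⊗ p′ q (sym ∘ eq) j)
⊗-congˡ (c ∷ p) []        q eq j = coeff-[]⊗ (c ∷ p) q eq j
⊗-congˡ (c ∷ p) (c′ ∷ p′) q eq j = begin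
  coeff ((c ∷ p) ⊗ q) j
    ≡⟨ coeff-∷⊗ c p q j ⟩
  c *ᶻ coeff q j +ᶻ shift (coeff (p ⊗ q)) j
    ≡⟨ cong₂ _+ᶻ_ (cong (_*ᶻ coeff q j) (eq 0)) (shift-cong (⊗-congˡ p p′ q (eq ∘ suc)) j) ⟩
  c′ *ᶻ coeff q j +ᶻ shift (coeff (p′ ⊗ q)) j
    ≡⟨ coeff-∷⊗ c′ p′ q j ⟨
  coeff ((c′ ∷ p′) ⊗ q) j ∎
  where open ≡-Reasoning

coeff-1⊗ : ∀ q → coeff ((1ℤ ∷ []) ⊗ q) ≗ coeff q
coeff-1⊗ q j = trans (coeff-∷⊗ 1ℤ [] q j) (trans (cong₂ _+ᶻ_ (ℤ.*-identityˡ (coeff q j)) (shift-0 j))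
  (ℤ.+-identityʳ (coeff q j)))

coeff-0∷⊗ : ∀ p q → coeff ((0ℤ ∷ p) ⊗ q) ≗ shift (coeff (p ⊗ q))
coeff-0∷⊗ p q j = trans (coeff-∷⊗ 0ℤ p q j)
  (trans (cong (_+ᶻ shift (coeff (p ⊗ q)) j) (ℤ.*-zeroˡ (coeff q j))) (ℤ.+-identityˡ _))

coeff-Z⊗ : ∀ p → coeff (Z ⊗ p) ≗ coeff (0ℤ ∷ p)
coeff-Z⊗ p j = trans (coeff-0∷⊗ (1ℤ ∷ []) p j) (trans (shift-cong (coeff-1⊗ p) j) (sym (coeff-0∷ p j)))

coeff-1-Z⊗ : ∀ p → coeff (1-Z ⊗ p) ≗ Δ (coeff p)
coeff-1-Z⊗ p j = trans (coeff-∷⊗ 1ℤ (-1ℤ ∷ []) p j)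
  (cong₂ _+ᶻ_ (ℤ.*-identityˡ (coeff p j)) (neg j))
  where
  neg : ∀ j → shift (coeff ((-1ℤ ∷ []) ⊗ p)) j ≡ -ᶻ shift (coeff p) j
  neg zero    = refl
  neg (suc j) = trans (coeff-∷⊗ -1ℤ [] p j) (trans
    (cong₂ _+ᶻ_ (ℤ.-1*i≡-i (coeff p j)) (shift-0 j)) (ℤ.+-identityʳ _))

-- Replacing the left factor `Z ⊗ Z ↑ i` by a list with the same coefficients takes the place of
-- associativity of `⊗`.
coeff-Z↑⊗ : ∀ i q → coeff (Z ↑ suc i ⊗ q) ≗ shift (coeff (Z ↑ i ⊗ q))
coeff-Z↑⊗ i q j = trans (⊗-congˡ (Z ⊗ Z ↑ i) (0ℤ ∷ Z ↑ i) q (coeff-Z⊗ (Z ↑ i)) j) (coeff-0∷⊗ (Z ↑ i) q j)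

-- The factor 1 - z moves past each factor z because `Δ` commutes with `shift`.
coeff-Z↑⊗1-Z⊗ : ∀ i q → coeff (Z ↑ i ⊗ (1-Z ⊗ q)) ≗ Δ (coeff (Z ↑ i ⊗ q))
coeff-Z↑⊗1-Z⊗ zero    q j = begin
  coeff ((1ℤ ∷ []) ⊗ (1-Z ⊗ q)) j ≡⟨ coeff-1⊗ (1-Z ⊗ q) j ⟩
  coeff (1-Z ⊗ q) j               ≡⟨ coeff-1-Z⊗ q j ⟩
  Δ (coeff q) j                   ≡⟨ Δ-cong (coeff-1⊗ q) j ⟨
  Δ (coeff ((1ℤ ∷ []) ⊗ q)) j     ∎
  where open ≡-Reasoning
coeff-Z↑⊗1-Z⊗ (suc i) q j = begin
  coeff (Z ↑ suc i ⊗ (1-Z ⊗ q)) j     ≡⟨ coeff-Z↑⊗ i (1-Z ⊗ q) j ⟩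
  shift (coeff (Z ↑ i ⊗ (1-Z ⊗ q))) j ≡⟨ shift-cong (coeff-Z↑⊗1-Z⊗ i q) j ⟩
  shift (Δ (coeff (Z ↑ i ⊗ q))) j     ≡⟨ Δ-shift (coeff (Z ↑ i ⊗ q)) j ⟨
  Δ (shift (coeff (Z ↑ i ⊗ q))) j     ≡⟨ Δ-cong (coeff-Z↑⊗ i q) j ⟨
  Δ (coeff (Z ↑ suc i ⊗ q)) j         ∎
  where open ≡-Reasoning

coeff-Z↑-≡ : ∀ i → coeff (Z ↑ i ⊗ (1ℤ ∷ [])) i ≡ 1ℤ
coeff-Z↑-≡ zero    = refl
coeff-Z↑-≡ (suc i) = trans (coeff-Z↑⊗ i (1ℤ ∷ []) (suc i)) (coeff-Z↑-≡ i)

coeff-Z↑-≢ : ∀ i j → i ≢ j → coeff (Z ↑ i ⊗ (1ℤ ∷ [])) j ≡ 0ℤ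
coeff-Z↑-≢ zero    zero    i≢j = contradiction refl i≢j
coeff-Z↑-≢ zero    (suc j) i≢j = refl
coeff-Z↑-≢ (suc i) zero    i≢j = coeff-Z↑⊗ i (1ℤ ∷ []) zero
coeff-Z↑-≢ (suc i) (suc j) i≢j = trans (coeff-Z↑⊗ i (1ℤ ∷ []) (suc j)) (coeff-Z↑-≢ i j (i≢j ∘ cong suc))

-- `Σ≤` folds from the first index, while induction on r splits off the last one; hence the passage
-- to `∷ʳ`.
Σ≤-suc : ∀ r f → coeff (Σ≤ (suc r) f) ≗ λ j → coeff (Σ≤ r f) j +ᶻ coeff (f (suc r)) j
Σ≤-suc r f j = begin
  coeff (foldr _⊕_ [] (map f (upTo (2 + r)))) j
    ≡⟨ cong (λ is → coeff (foldr _⊕_ [] (map f is)) j) (upTo-∷ʳ (suc r)) ⟨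
  coeff (foldr _⊕_ [] (map f (upTo (suc r) ∷ʳ suc r))) j
    ≡⟨ foldr-∷ʳ (upTo (suc r)) ⟩
  coeff (Σ≤ r f) j +ᶻ coeff (f (suc r)) j ∎
  where
  open ≡-Reasoning
  foldr-∷ʳ : ∀ is → coeff (foldr _⊕_ [] (map f (is ∷ʳ suc r))) j
                    ≡ coeff (foldr _⊕_ [] (map f is)) j +ᶻ coeff (f (suc r)) j
  foldr-∷ʳ []       = trans (coeff-⊕ (f (suc r)) [] j) (ℤ.+-comm (coeff (f (suc r)) j) 0ℤ)
  foldr-∷ʳ (i ∷ is) = begin
    coeff (f i ⊕ foldr _⊕_ [] (map f (is ∷ʳ suc r))) j
      ≡⟨ coeff-⊕ (f i) _ j ⟩
    coeff (f i) j +ᶻ coeff (foldr _⊕_ [] (map f (is ∷ʳ suc r))) j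
      ≡⟨ cong (coeff (f i) j +ᶻ_) (foldr-∷ʳ is) ⟩
    coeff (f i) j +ᶻ (coeff (foldr _⊕_ [] (map f is)) j +ᶻ coeff (f (suc r)) j)
      ≡⟨ ℤ.+-assoc (coeff (f i) j) _ _ ⟨
    coeff (f i) j +ᶻ coeff (foldr _⊕_ [] (map f is)) j +ᶻ coeff (f (suc r)) j
      ≡⟨ cong (_+ᶻ coeff (f (suc r)) j) (coeff-⊕ (f i) _ j) ⟨
    coeff (f i ⊕ foldr _⊕_ [] (map f is)) j +ᶻ coeff (f (suc r)) j ∎

-- Linearity of `Δ`. The hypothesis stops at r because in `fromF-suc` it rests on (1 + r) ∸ i = 1 +
-- (r ∸ i), which fails beyond r.
Σ≤-Δ : ∀ r f g → (∀ i → i ≤ r → coeff (f i) ≗ Δ (coeff (g i))) →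
       coeff (Σ≤ r f) ≗ Δ (coeff (Σ≤ r g))
Σ≤-Δ zero    f g eq j = begin
  coeff (f 0 ⊕ []) j     ≡⟨ ⊕[] (f 0) j ⟩
  coeff (f 0) j          ≡⟨ eq 0 z≤n j ⟩
  Δ (coeff (g 0)) j      ≡⟨ Δ-cong (⊕[] (g 0)) j ⟨
  Δ (coeff (g 0 ⊕ [])) j ∎
  where
  open ≡-Reasoning
  ⊕[] : ∀ p → coeff (p ⊕ []) ≗ coeff p
  ⊕[] p j = trans (coeff-⊕ p [] j) (ℤ.+-identityʳ _)
Σ≤-Δ (suc r) f g eq j = begin
  coeff (Σ≤ (suc r) f) j
    ≡⟨ Σ≤-suc r f j ⟩
  coeff (Σ≤ r f) j +ᶻ coeff (f (suc r)) j
    ≡⟨ cong₂ _+ᶻ_ (Σ≤-Δ r f g (λ i i≤r → eq i (ℕ.m≤n⇒m≤1+n i≤r)) j) (eq (suc r) ℕ.≤-refl j) ⟩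
  Δ (coeff (Σ≤ r g)) j +ᶻ Δ (coeff (g (suc r))) j
    ≡⟨ Δ-+ (coeff (Σ≤ r g)) (coeff (g (suc r))) j ⟩
  Δ (λ j → coeff (Σ≤ r g) j +ᶻ coeff (g (suc r)) j) j
    ≡⟨ Δ-cong (Σ≤-suc r g) j ⟨
  Δ (coeff (Σ≤ (suc r) g)) j ∎
  where
  open ≡-Reasoning
  interchange : ∀ a b c d → (a - b) +ᶻ (c - d) ≡ (a +ᶻ c) - (b +ᶻ d)
  interchange = solve 4 (λ a b c d → (a :- b) :+ (c :- d) := (a :+ c) :- (b :+ d)) refl
    where open +-*-Solver
  Δ-+ : ∀ a b j → Δ a j +ᶻ Δ b j ≡ Δ (λ j → a j +ᶻ b j) j
  Δ-+ a b zero    = interchange (a 0) 0ℤ (b 0) 0ℤ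
  Δ-+ a b (suc j) = interchange (a (suc j)) (a j) (b (suc j)) (b j)

-- From f-vectors to h-polynomials, by recursion on the rank

summand : (ℕ → ℤ) → ℕ → ℕ → Poly
summand b r i = b i · (Z ↑ i ⊗ 1-Z ↑ (r ∸ i))

-- hPoly G ≼-total is fromF of the face numbers, definitionally.
fromF : (ℕ → ℤ) → ℕ → Poly
fromF b r = Σ≤ r (summand b r)

-- Raising r by one gives every old summand another factor 1 - z and adds a monomial: F_{r+1} = (1 -
-- z) F_r + b_{r+1} z^{r+1}.
fromF-suc : ∀ b r j → coeff (fromF b (suc r)) j ≡
            Δ (coeff (fromF b r)) j +ᶻ b (suc r) *ᶻ coeff (Z ↑ suc r ⊗ (1ℤ ∷ [])) j
fromF-suc b r j = trans (Σ≤-suc r (summand b (suc r)) j)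
  (cong₂ _+ᶻ_ (Σ≤-Δ r (summand b (suc r)) (summand b r) step j) last)
  where
  open ≡-Reasoning
  Δ-* : ∀ c a j → c *ᶻ Δ a j ≡ Δ (λ j → c *ᶻ a j) j
  Δ-* c a zero    = solve 2 (λ c x → c :* (x :- con 0ℤ) := c :* x :- con 0ℤ) refl c (a 0)
    where open +-*-Solver
  Δ-* c a (suc j) = solve 3 (λ c x y → c :* (x :- y) := c :* x :- c :* y) refl c (a (suc j)) (a j)
    where open +-*-Solver
  step : ∀ i → i ≤ r → coeff (summand b (suc r) i) ≗ Δ (coeff (summand b r i))
  step i i≤r j = begin
    coeff (b i · (Z ↑ i ⊗ 1-Z ↑ (suc r ∸ i))) j
      ≡⟨ coeff-· (b i) (Z ↑ i ⊗ 1-Z ↑ (suc r ∸ i)) j ⟩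
    b i *ᶻ coeff (Z ↑ i ⊗ 1-Z ↑ (suc r ∸ i)) j
      ≡⟨ cong (λ s → b i *ᶻ coeff (Z ↑ i ⊗ 1-Z ↑ s) j) (ℕ.+-∸-assoc 1 i≤r) ⟩
    b i *ᶻ coeff (Z ↑ i ⊗ (1-Z ⊗ 1-Z ↑ (r ∸ i))) j
      ≡⟨ cong (b i *ᶻ_) (coeff-Z↑⊗1-Z⊗ i (1-Z ↑ (r ∸ i)) j) ⟩
    b i *ᶻ Δ (coeff (Z ↑ i ⊗ 1-Z ↑ (r ∸ i))) j
      ≡⟨ Δ-* (b i) (coeff (Z ↑ i ⊗ 1-Z ↑ (r ∸ i))) j ⟩
    Δ (λ j → b i *ᶻ coeff (Z ↑ i ⊗ 1-Z ↑ (r ∸ i)) j) j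
      ≡⟨ Δ-cong (coeff-· (b i) (Z ↑ i ⊗ 1-Z ↑ (r ∸ i))) j ⟨
    Δ (coeff (b i · (Z ↑ i ⊗ 1-Z ↑ (r ∸ i)))) j ∎
  last : coeff (b (suc r) · (Z ↑ suc r ⊗ 1-Z ↑ (r ∸ r))) j ≡ b (suc r) *ᶻ coeff (Z ↑ suc r ⊗ (1ℤ ∷ [])) j
  last = trans (coeff-· (b (suc r)) (Z ↑ suc r ⊗ 1-Z ↑ (r ∸ r)) j)
               (cong (λ s → b (suc r) *ᶻ coeff (Z ↑ suc r ⊗ 1-Z ↑ s) j) (ℕ.n∸n≡0 r))

fromF-suc-≢ : ∀ b r j → suc r ≢ j → coeff (fromF b (suc r)) j ≡ Δ (coeff (fromF b r)) j
fromF-suc-≢ b r j r≢j = begin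
  coeff (fromF b (suc r)) j
    ≡⟨ fromF-suc b r j ⟩
  Δ (coeff (fromF b r)) j +ᶻ b (suc r) *ᶻ coeff (Z ↑ suc r ⊗ (1ℤ ∷ [])) j
    ≡⟨ cong (λ x → Δ (coeff (fromF b r)) j +ᶻ b (suc r) *ᶻ x) (coeff-Z↑-≢ (suc r) j r≢j) ⟩
  Δ (coeff (fromF b r)) j +ᶻ b (suc r) *ᶻ 0ℤ
    ≡⟨ cong (Δ (coeff (fromF b r)) j +ᶻ_) (ℤ.*-zeroʳ (b (suc r))) ⟩
  Δ (coeff (fromF b r)) j +ᶻ 0ℤ
    ≡⟨ ℤ.+-identityʳ _ ⟩
  Δ (coeff (fromF b r)) j ∎
  where open ≡-Reasoning

fromF-degree : ∀ b r j → r < j → coeff (fromF b r) j ≡ 0ℤ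
fromF-degree b zero    (suc j) _         = refl
fromF-degree b (suc r) (suc j) (s≤s r<j) = begin
  coeff (fromF b (suc r)) (suc j)
    ≡⟨ fromF-suc-≢ b r (suc j) (ℕ.<⇒≢ (s≤s r<j)) ⟩
  coeff (fromF b r) (suc j) - coeff (fromF b r) j
    ≡⟨ cong₂ _-_ (fromF-degree b r (suc j) (ℕ.m<n⇒m<1+n r<j)) (fromF-degree b r j r<j) ⟩
  0ℤ ∎
  where open ≡-Reasoning

-- As `fromF b r` has degree at most r, only its shifted copy and the new monomial reach degree r +
-- 1.
fromF-suc-top : ∀ b r → coeff (fromF b (suc r)) (suc r) ≡ b (suc r) - coeff (fromF b r) r
fromF-suc-top b r = begin
  coeff (fromF b (suc r)) (suc r)
    ≡⟨ fromF-suc b r (suc r) ⟩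
  (coeff (fromF b r) (suc r) - coeff (fromF b r) r) +ᶻ b (suc r) *ᶻ coeff (Z ↑ suc r ⊗ (1ℤ ∷ [])) (suc r)
    ≡⟨ cong₂ (λ x y → (x - coeff (fromF b r) r) +ᶻ b (suc r) *ᶻ y)
             (fromF-degree b r (suc r) ℕ.≤-refl) (coeff-Z↑-≡ (suc r)) ⟩
  (0ℤ - coeff (fromF b r) r) +ᶻ b (suc r) *ᶻ 1ℤ
    ≡⟨ solve 2 (λ x y → (con 0ℤ :- x) :+ y :* con 1ℤ := y :- x) refl (coeff (fromF b r) r) (b (suc r)) ⟩
  b (suc r) - coeff (fromF b r) r ∎
  where
  open ≡-Reasoning
  open +-*-Solver

pascal : ∀ n k → + (suc n C suc k) - + (n C k) ≡ + (n C suc k)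
pascal n k = begin
  + (suc n C suc k) - + (n C k)
    ≡⟨ cong (λ x → + x - + (n C k)) (nCk+nC[k+1]≡[n+1]C[k+1] n k) ⟨
  (+ (n C k) +ᶻ + (n C suc k)) - + (n C k)
    ≡⟨ solve 2 (λ x y → (x :+ y) :- x := y) refl (+ (n C k)) (+ (n C suc k)) ⟩
  + (n C suc k) ∎
  where
  open ≡-Reasoning
  open +-*-Solver

-- With f-vector C(n, i) the polynomial is (1 - z)^(r - n) modulo z^(r + 1); a
-- perturbation δ of the f-vector that starts in degree k changes no
-- coefficient below k and enters the one in degree k unchanged.
coeff-fromF : ∀ b (δ : ℕ → ℤ) k n → (∀ i → i < k → δ i ≡ 0ℤ) →
              (∀ i → i ≤ k → b i ≡ + (n C i) - δ i) →
              ∀ r m → n ≡ m + r → ∀ j → j ≤ r → j ≤ k →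
              coeff (fromF b r) j ≡ + ((m + j ∸ 1) C j) - δ j
coeff-fromF b δ k n δ<k b≤k zero m n≡m+r .0 z≤n _ = begin
  coeff (b 0 · (1ℤ ∷ []) ⊕ []) 0 ≡⟨⟩
  b 0 *ᶻ 1ℤ                      ≡⟨ ℤ.*-identityʳ (b 0) ⟩
  b 0                            ≡⟨ b≤k 0 z≤n ⟩
  -- A binomial coefficient over 0 is 1 whatever its upper entry, so truncation in `m + 0 ∸ 1` at m
  -- = 0 does no harm.
  1ℤ - δ 0                       ∎
  where open ≡-Reasoning
coeff-fromF b δ k n δ<k b≤k (suc r) m n≡m+r zero _ _ = begin
  coeff (fromF b (suc r)) 0 ≡⟨ fromF-suc-≢ b r 0 (λ ()) ⟩
  coeff (fromF b r) 0 - 0ℤ  ≡⟨ ℤ.+-identityʳ _ ⟩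
  coeff (fromF b r) 0       ≡⟨ coeff-fromF b δ k n δ<k b≤k r (suc m) (trans n≡m+r (ℕ.+-suc m r)) 0 z≤n z≤n ⟩
  1ℤ - δ 0                  ∎
  where open ≡-Reasoning
coeff-fromF b δ k n δ<k b≤k (suc r) m n≡m+r (suc j) (s≤s j≤r) j<k = body
  where
  open ≡-Reasoning
  IH : ∀ j → j ≤ r → j ≤ k → coeff (fromF b r) j ≡ + ((m + j) C j) - δ j
  IH = coeff-fromF b δ k n δ<k b≤k r (suc m) (trans n≡m+r (ℕ.+-suc m r))

  -- Here j < k, so the subtracted coefficient brings in no second error term.
  IHj : coeff (fromF b r) j ≡ + ((m + j) C j)
  IHj = trans (IH j j≤r (ℕ.<⇒≤ j<k)) (trans (cong (λ x → + ((m + j) C j) - x) (δ<k j j<k)) (ℤ.+-identityʳ _))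

  combine : ∀ {x} → x ≡ + (suc (m + j) C suc j) - δ (suc j) →
            x - coeff (fromF b r) j ≡ + ((m + suc j ∸ 1) C suc j) - δ (suc j)
  combine {x} x≡ = begin
    x - coeff (fromF b r) j
      ≡⟨ cong₂ _-_ x≡ IHj ⟩
    (+ (suc (m + j) C suc j) - δ (suc j)) - + ((m + j) C j)
      ≡⟨ solve 3 (λ x e y → (x :- e) :- y := (x :- y) :- e) refl
                 (+ (suc (m + j) C suc j)) (δ (suc j)) (+ ((m + j) C j)) ⟩
    (+ (suc (m + j) C suc j) - + ((m + j) C j)) - δ (suc j)
      ≡⟨ cong (_- δ (suc j)) (pascal (m + j) j) ⟩
    + ((m + j) C suc j) - δ (suc j)
      ≡⟨ cong (λ x → + ((x ∸ 1) C suc j) - δ (suc j)) (ℕ.+-suc m j) ⟨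
    + ((m + suc j ∸ 1) C suc j) - δ (suc j) ∎
    where open +-*-Solver

  body : coeff (fromF b (suc r)) (suc j) ≡ + ((m + suc j ∸ 1) C suc j) - δ (suc j)
  -- In the top degree r + 1 the f-vector itself supplies the value, because n = suc (m + r); in
  -- lower degrees the induction hypothesis does.
  body with j ℕ.≟ r
  ... | yes refl = trans (fromF-suc-top b r) (combine (trans (b≤k (suc j) j<k)
                     (cong (λ x → + (x C suc j) - δ (suc j)) (trans n≡m+r (ℕ.+-suc m r)))))
  ... | no j≢r = trans (fromF-suc-≢ b r (suc j) (j≢r ∘ sym ∘ ℕ.suc-injective))
                   (combine (trans (IH (suc j) (ℕ.≤∧≢⇒< j≤r j≢r) j<k)
                     (cong (λ x → + (x C suc j) - δ (suc j)) (ℕ.+-suc m j))))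

-- Finite subsets

x∉p-x : ∀ (p : Subset n) x → x ∉ p ∖ x
x∉p-x (inside  ∷ p) zero    ()
x∉p-x (outside ∷ p) zero    ()
x∉p-x (_       ∷ p) (suc x) (there x∈) = x∉p-x p x x∈

x∈p⇒∣p∣≡1+∣p-x∣ : ∀ {p : Subset n} {x} → x ∈ p → ∣ p ∣ ≡ suc ∣ p ∖ x ∣
x∈p⇒∣p∣≡1+∣p-x∣ {p = inside  ∷ p} here        = cong (suc ∘ ∣_∣) (sym (p─⊥≡p p))
x∈p⇒∣p∣≡1+∣p-x∣ {p = inside  ∷ p} (there x∈p) = cong suc (x∈p⇒∣p∣≡1+∣p-x∣ x∈p)
x∈p⇒∣p∣≡1+∣p-x∣ {p = outside ∷ p} (there x∈p) = x∈p⇒∣p∣≡1+∣p-x∣ x∈p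

x∉p⇒∣p∪⁅x⁆∣≡1+∣p∣ : ∀ {p : Subset n} {x} → x ∉ p → ∣ p ∪ ⁅ x ⁆ ∣ ≡ suc ∣ p ∣
x∉p⇒∣p∪⁅x⁆∣≡1+∣p∣ {p = p} {x} x∉p = trans (x∈p⇒∣p∣≡1+∣p-x∣ (q⊆p∪q p ⁅ x ⁆ (x∈⁅x⁆ x)))
                                          (cong (suc ∘ ∣_∣) (⊆-antisym left right))
  where
  left : (p ∪ ⁅ x ⁆) ∖ x ⊆ p
  left {y} y∈ with x∈p∪q⁻ p ⁅ x ⁆ (p─q⊆p (p ∪ ⁅ x ⁆) ⁅ x ⁆ y∈)
  ... | inj₁ y∈p = y∈p
  ... | inj₂ y∈x = contradiction (subst (_∈ (p ∪ ⁅ x ⁆) ∖ x) (x∈⁅y⁆⇒x≡y x y∈x) y∈) (x∉p-x (p ∪ ⁅ x ⁆) x)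
  right : p ⊆ (p ∪ ⁅ x ⁆) ∖ x
  right y∈p = x∈p∧x≢y⇒x∈p-y (p⊆p∪q ⁅ x ⁆ y∈p) λ { refl → x∉p y∈p }

p⊆q∧∣q∣≤∣p∣⇒p≡q : ∀ {p q : Subset n} → p ⊆ q → ∣ q ∣ ≤ ∣ p ∣ → p ≡ q
p⊆q∧∣q∣≤∣p∣⇒p≡q {p = p} {q} p⊆q ∣q∣≤∣p∣ = ⊆-antisym p⊆q q⊆p
  where
  q⊆p : q ⊆ p
  q⊆p {x} x∈q with x ∈? p
  ... | yes x∈p = x∈p
  ... | no  x∉p = contradiction ∣q∣≤∣p∣ (ℕ.<⇒≱ (p⊂q⇒∣p∣<∣q∣ (p⊆q , x , x∈q , x∉p)))

removal-injective : ∀ {p q : Subset n} {x} → x ∈ p → x ∈ q → p ∖ x ≡ q ∖ x → p ≡ q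
removal-injective x∈p x∈q eq = ⊆-antisym (half x∈q eq) (half x∈p (sym eq))
  where
  half : ∀ {p q : Subset n} {x} → x ∈ q → p ∖ x ≡ q ∖ x → p ⊆ q
  half {q = q} {x} x∈q eq {y} y∈p with y ≟ x
  ... | yes refl = x∈q
  ... | no  y≢x  = p─q⊆p q ⁅ x ⁆ (subst (y ∈_) eq (x∈p∧x≢y⇒x∈p-y y∈p y≢x))

-- Deleting `f zero` lowers the size by at most one and leaves a set covered by the remaining
-- values.
covered⇒∣p∣≤ : ∀ m (p : Subset n) (f : Fin m → Fin n) →
               (∀ {x} → x ∈ p → ∃[ i ] x ≡ f i) → ∣ p ∣ ≤ m
covered⇒∣p∣≤ {n} zero p f cover = ℕ.≤-reflexive (trans (cong ∣_∣ (Empty-unique empty)) (∣⊥∣≡0 n))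
  where
  empty : Empty p
  empty (x , x∈p) with cover x∈p
  ... | () , _
covered⇒∣p∣≤ (suc m) p f cover = ℕ.≤-trans ∣p∣≤1+∣p-x∣ (s≤s (covered⇒∣p∣≤ m (p ∖ x) (f ∘ suc) cover′))
  where
  x = f zero
  cover′ : ∀ {y} → y ∈ p ∖ x → ∃[ i ] y ≡ f (suc i)
  cover′ {y} y∈ with cover (p─q⊆p p ⁅ x ⁆ y∈)
  ... | zero  , refl = contradiction y∈ (x∉p-x p x)
  ... | suc i , eq   = i , eq
  ∣p∣≤1+∣p-x∣ : ∣ p ∣ ≤ suc ∣ p ∖ x ∣
  ∣p∣≤1+∣p-x∣ with x ∈? p
  ... | yes x∈p = ℕ.≤-reflexive (x∈p⇒∣p∣≡1+∣p-x∣ x∈p)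
  ... | no  x∉p = ℕ.m≤n⇒m≤1+n (p⊆q⇒∣p∣≤∣q∣ {p = p} {q = p ∖ x} λ y∈p →
    x∈p∧x≢y⇒x∈p-y y∈p λ { refl → x∉p y∈p })

-- Totality and transitivity both restrict along `suc`, so the recursion can pass to the tail of the
-- subset.
maximum : {_≼_ : Rel (Fin n) ℓ} → Total _≼_ → Transitive _≼_ →
          ∀ (p : Subset n) → Nonempty p → ∃[ x ] (x ∈ p × (∀ y → y ∈ p → y ≼ x))
maximum {n = suc n} {_≼_ = _≼_} total ≼-trans (s ∷ p) (x , x∈p) with nonempty? p
maximum total ≼-trans (s ∷ p) (zero  , here) | no empty = zero , here , λ where
  -- At equal arguments both alternatives of totality coincide, which gives reflexivity.
  zero    _           → reduce (total zero zero)
  (suc y) (there y∈p) → contradiction (y , y∈p) empty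
maximum total ≼-trans (s ∷ p) (suc x , x∈p) | no empty = contradiction (x , drop-there x∈p) empty
maximum total ≼-trans (outside ∷ p) _ | yes ne
  with maximum (λ x y → total (suc x) (suc y)) ≼-trans p ne
... | x , x∈p , max = suc x , there x∈p , λ { (suc y) (there y∈p) → max y y∈p }
maximum total ≼-trans (inside ∷ p) _ | yes ne
  with maximum (λ x y → total (suc x) (suc y)) ≼-trans p ne
... | x , x∈p , max with total zero (suc x)
...   | inj₁ 0≼x = suc x , there x∈p , λ where
  zero    _           → 0≼x
  (suc y) (there y∈p) → max y y∈p
...   | inj₂ x≼0 = zero , here , λ where
  zero    _           → reduce (total zero zero)
  (suc y) (there y∈p) → ≼-trans (max y y∈p) x≼0

-- Counting subsets

∈-subsets : ∀ (p : Subset n) → p ∈ˡ subsets n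
∈-subsets []            = here refl
∈-subsets (outside ∷ p) = ∈-++⁺ˡ (∈-map⁺ (outside ∷_) (∈-subsets p))
∈-subsets (inside  ∷ p) = ∈-++⁺ʳ _ (∈-map⁺ (inside ∷_) (∈-subsets p))

subsets-unique : ∀ n → Unique (subsets n)
subsets-unique zero    = All.[] ∷ []
subsets-unique (suc n) = Unique.++⁺ (Unique.map⁺ ∷-injectiveʳ (subsets-unique n))
                                    (Unique.map⁺ ∷-injectiveʳ (subsets-unique n)) disjoint
  where
  disjoint : ∀ {p} → p ∈ˡ map (outside ∷_) (subsets n) × p ∈ˡ map (inside ∷_) (subsets n) → Empty.⊥
  disjoint (o , i) with ∈-map⁻ (outside ∷_) o | ∈-map⁻ (inside ∷_) i
  ... | _ , _ , refl | _ , _ , ()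

filter-map : ∀ {P : Pred B p} (P? : Decidable P) (f : A → B) xs →
             filter P? (map f xs) ≡ map f (filter (P? ∘ f) xs)
filter-map P? f []       = refl
filter-map P? f (x ∷ xs) with P? (f x)
... | yes _ = cong (f x ∷_) (filter-map P? f xs)
... | no  _ = filter-map P? f xs

count-∷ : ∀ {P : Pred (Subset (suc n)) p} (P? : Decidable P) →
          count P? ≡ count (P? ∘ (outside ∷_)) + count (P? ∘ (inside ∷_))
count-∷ {n} P? = begin
  length (filter P? (os ++ is))
    ≡⟨ cong length (filter-++ P? os is) ⟩
  length (filter P? os ++ filter P? is)
    ≡⟨ length-++ (filter P? os) ⟩
  length (filter P? os) + length (filter P? is)
    ≡⟨ cong₂ _+_ (length-filter-map outside) (length-filter-map inside) ⟩
  count (P? ∘ (outside ∷_)) + count (P? ∘ (inside ∷_)) ∎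
  where
  open ≡-Reasoning
  os = map (outside ∷_) (subsets n)
  is = map (inside ∷_) (subsets n)
  length-filter-map : ∀ s → length (filter P? (map (s ∷_) (subsets n))) ≡ count (P? ∘ (s ∷_))
  length-filter-map s = trans (cong length (filter-map P? (s ∷_) (subsets n)))
                              (length-map (s ∷_) (filter (P? ∘ (s ∷_)) (subsets n)))

count-size : ∀ n i → count {n} (λ p → ∣ p ∣ ℕ.≟ i) ≡ n C i
count-size zero    zero    = refl
count-size zero    (suc i) = refl
count-size (suc n) zero    = begin
  count {suc n} (λ p → ∣ p ∣ ℕ.≟ 0)
    ≡⟨ count-∷ {n} (λ p → ∣ p ∣ ℕ.≟ 0) ⟩
  count {n} (λ p → ∣ p ∣ ℕ.≟ 0) + count {n} (λ p → suc ∣ p ∣ ℕ.≟ 0)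
    ≡⟨ cong₂ _+_ (count-size n 0) (cong length
         (filter-none (λ p → suc ∣ p ∣ ℕ.≟ 0) {subsets n} (All.tabulate λ _ ()))) ⟩
  1 ∎
  where open ≡-Reasoning
count-size (suc n) (suc i) = begin
  count {suc n} (λ p → ∣ p ∣ ℕ.≟ suc i)
    ≡⟨ count-∷ {n} (λ p → ∣ p ∣ ℕ.≟ suc i) ⟩
  count {n} (λ p → ∣ p ∣ ℕ.≟ suc i) + count {n} (λ p → suc ∣ p ∣ ℕ.≟ suc i)
    ≡⟨ cong₂ _+_ (count-size n (suc i)) (trans (cong length
         (filter-≐ (λ p → suc ∣ p ∣ ℕ.≟ suc i) (λ p → ∣ p ∣ ℕ.≟ i) (ℕ.suc-injective , cong suc) (subsets n)))
         (count-size n i)) ⟩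
  n C suc i + n C i
    ≡⟨ ℕ.+-comm (n C suc i) (n C i) ⟩
  n C i + n C suc i
    ≡⟨ nCk+nC[k+1]≡[n+1]C[k+1] n i ⟩
  suc n C suc i ∎
  where open ≡-Reasoning

count-split : ∀ {P : Pred (Subset n) p} {Q : Pred (Subset n) q} (P? : Decidable P) (Q? : Decidable Q) →
              count (λ s → P? s ×-dec Q? s) + count (λ s → ¬? (P? s) ×-dec Q? s) ≡ count Q?
count-split {n} P? Q? = go (subsets n)
  where
  go : ∀ ss → length (filter (λ s → P? s ×-dec Q? s) ss) + length (filter (λ s → ¬? (P? s) ×-dec Q? s) ss)
              ≡ length (filter Q? ss)
  go []       = refl
  go (s ∷ ss) with P? s | Q? s
  ... | yes _ | yes _ = cong suc (go ss)
  ... | yes _ | no  _ = go ss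
  ... | no  _ | yes _ = trans (ℕ.+-suc _ _) (cong suc (go ss))
  ... | no  _ | no  _ = go ss

lookup-injective : ∀ {xs : List A} → Unique xs → ∀ {i j} → lookup xs i ≡ lookup xs j → i ≡ j
lookup-injective (x∉xs ∷ uniq) {zero}  {zero}  eq = refl
lookup-injective (x∉xs ∷ uniq) {zero}  {suc j} eq = contradiction eq (All.lookup x∉xs (∈-lookup j))
lookup-injective (x∉xs ∷ uniq) {suc i} {zero}  eq = contradiction (sym eq) (All.lookup x∉xs (∈-lookup i))
lookup-injective (x∉xs ∷ uniq) {suc i} {suc j} eq = cong suc (lookup-injective uniq eq)

-- A relation stands in for the injective function because the image is built from a proof of P s
-- and not from s alone. Positions in the two filtered lists turn it into an injection between `Fin`
-- types.
count-injection : ∀ {P : Pred (Subset m) p} {Q : Pred (Subset n) q} (P? : Decidable P) (Q? : Decidable Q)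
                  (R : Subset m → Subset n → Set ℓ) → (∀ {s} → P s → ∃[ t ] (Q t × R s t)) →
                  (∀ {s s′ t} → P s → P s′ → R s t → R s′ t → s ≡ s′) → count P? ≤ count Q?
count-injection {m = m} {n = n} {P = P} {Q} P? Q? R image R-injective =
  injective⇒≤ {f = index ∘ image∈} λ {i} {j} eq →
    lookup-injective (Unique.filter⁺ P? (subsets-unique m))
      (R-injective (holds i) (holds j) (proj₂ (proj₂ (image (holds i))))
        (subst (R _) (sym (Membership.index-injective (setoid _) (image∈ i) (image∈ j) eq))
                     (proj₂ (proj₂ (image (holds j))))))
  where
  ss = filter P? (subsets m)
  holds : ∀ i → P (lookup ss i)
  holds i = proj₂ (∈-filter⁻ P? {xs = subsets m} (∈-lookup i))
  image∈ : ∀ i → proj₁ (image (holds i)) ∈ˡ filter Q? (subsets n)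
  image∈ i = ∈-filter⁺ Q? (∈-subsets _) (proj₁ (proj₂ (image (holds i))))

-- Cycles and trees

-- Replaces the arithmetic modulo 3 + k by two cases, without and with wraparound, from which the
-- facts about `next` are read off.
toℕ-next : ∀ (i : Fin (3 + k)) →
           (toℕ i < 2 + k × toℕ (next i) ≡ suc (toℕ i)) ⊎ (toℕ i ≡ 2 + k × toℕ (next i) ≡ 0)
toℕ-next {k} i with suc (toℕ i) ℕ.<? 3 + k
... | yes 1+i<3+k = inj₁ (ℕ.≤-pred 1+i<3+k , trans (toℕ-fromℕ< (m%n<n (suc (toℕ i)) (3 + k))) (m<n⇒m%n≡m 1+i<3+k))
... | no  1+i≮3+k = inj₂ (i≡2+k , trans (toℕ-fromℕ< (m%n<n (suc (toℕ i)) (3 + k)))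
                                       (trans (cong (λ x → suc x % (3 + k)) i≡2+k) (n%n≡0 (3 + k))))
  where
  i≡2+k : toℕ i ≡ 2 + k
  i≡2+k = ℕ.≤-antisym (ℕ.≤-pred (toℕ<n i)) (ℕ.≤-pred (ℕ.≮⇒≥ 1+i≮3+k))

next-injective : ∀ {i j : Fin (3 + k)} → next i ≡ next j → i ≡ j
next-injective {i = i} {j} eq with toℕ-next i | toℕ-next j
... | inj₁ (_ , p) | inj₁ (_ , q) = toℕ-injective (ℕ.suc-injective (trans (sym p) (trans (cong toℕ eq) q)))
... | inj₁ (_ , p) | inj₂ (_ , q) = contradiction (trans (sym p) (trans (cong toℕ eq) q)) λ ()
... | inj₂ (_ , p) | inj₁ (_ , q) = contradiction (trans (sym q) (trans (cong toℕ (sym eq)) p)) λ ()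
... | inj₂ (p , _) | inj₂ (q , _) = toℕ-injective (trans p (sym q))

next-surjective : ∀ (j : Fin (3 + k)) → ∃[ i ] next i ≡ j
next-surjective {k} zero with toℕ-next (fromℕ (2 + k))
... | inj₁ (p , _) = contradiction (toℕ-fromℕ (2 + k)) (ℕ.<⇒≢ p)
... | inj₂ (_ , q) = fromℕ (2 + k) , toℕ-injective q
next-surjective {k} (suc j) with toℕ-next (inject₁ j)
... | inj₁ (_ , q) = inject₁ j , toℕ-injective (trans q (cong suc (toℕ-inject₁ j)))
... | inj₂ (p , _) = contradiction (trans (sym (toℕ-inject₁ j)) p) (ℕ.<⇒≢ (toℕ<n j))

-- The length being at least three enters here: one wraparound in two steps would force 2 + k = 1,
-- and two would force 2 + k = 0.
next-next≢ : ∀ (i : Fin (3 + k)) → next (next i) ≢ i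
next-next≢ i eq with toℕ-next i | toℕ-next (next i)
... | inj₁ (_ , p) | inj₁ (_ , q) = contradiction
  (trans (sym (cong toℕ eq)) (trans q (cong suc p))) (ℕ.<⇒≢ (ℕ.m<n⇒m<1+n (ℕ.n<1+n _)))
... | inj₁ (_ , p) | inj₂ (q , r) with trans (sym (cong suc (trans (sym (cong toℕ eq)) r))) (trans (sym p) q)
...   | ()
next-next≢ i eq | inj₂ (p , q) | inj₁ (_ , r) with trans (sym (trans r (cong suc q))) (trans (cong toℕ eq) p)
...   | ()
next-next≢ i eq | inj₂ (p , q) | inj₂ (r , _) with trans (sym q) r
...   | ()

next≢ : ∀ (i : Fin (3 + k)) → next i ≢ i
next≢ i eq = next-next≢ i (trans (cong next eq) eq)

module _ (G : Graph) where
  open Graph G hiding (Edge; EdgeSet)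

  Incident : Edge G → Vertex → Set
  Incident e u = ∃[ w ] Joins e u w

  joins-unique : ∀ {e a b c d} → Joins e a b → Joins e c d → (a ≡ c × b ≡ d) ⊎ (a ≡ d × b ≡ c)
  joins-unique (inj₁ p) (inj₁ q) = inj₁ (,-injective (trans (sym p) q))
  joins-unique (inj₁ p) (inj₂ q) = inj₂ (,-injective (trans (sym p) q))
  joins-unique (inj₂ p) (inj₁ q) with ,-injective (trans (sym p) q)
  ... | b≡c , a≡d = inj₂ (a≡d , b≡c)
  joins-unique (inj₂ p) (inj₂ q) with ,-injective (trans (sym p) q)
  ... | b≡d , a≡c = inj₁ (a≡c , b≡d)

  incident⇒endpoint : ∀ {e a b u} → Joins e a b → Incident e u → u ≡ a ⊎ u ≡ b
  incident⇒endpoint e-ab (w , e-uw) with joins-unique e-uw e-ab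
  ... | inj₁ (u≡a , _) = inj₁ u≡a
  ... | inj₂ (u≡b , _) = inj₂ u≡b

  module _ {v : Vec Vertex (3 + k)} {Γ : EdgeSet G} (t : CycleThrough G v Γ) where
    open CycleThrough t

    side : Fin (3 + k) → Edge G
    side i = proj₁ (adjacent i)

    side-joins : ∀ i → Joins (side i) (lookupᵛ v i) (lookupᵛ v (next i))
    side-joins i = proj₂ (adjacent i)

    side∈Γ : ∀ i → side i ∈ Γ
    side∈Γ i = Equivalence.from (edges (side i)) (i , side-joins i)

    ∈Γ⇒side : ∀ {e} → e ∈ Γ → ∃[ i ] e ≡ side i
    ∈Γ⇒side {e} e∈Γ with Equivalence.to (edges e) e∈Γ
    ... | i , e-joins = i , noMultiple e-joins (side-joins i)

    -- An edge traversed in opposite directions as sides i and j would give i = next j and next i =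
    -- j, against `next-next≢`.
    side-injective : ∀ {i j} → side i ≡ side j → i ≡ j
    side-injective {i} {j} eq
      with joins-unique (subst (λ e → Joins e _ _) eq (side-joins i)) (side-joins j)
    ... | inj₁ (vi≡vj , _)       = distinct vi≡vj
    ... | inj₂ (vi≡vnj , vni≡vj) = contradiction
      (trans (cong next (sym (distinct vi≡vnj))) (distinct vni≡vj)) (next-next≢ j)

    -- With `no-third-edge` this says that vertices on a cycle have degree exactly two: vertex i
    -- meets side i and the side before it.
    second-edge : ∀ {e u} → e ∈ Γ → Incident e u → ∃[ f ] (f ∈ Γ × f ≢ e × Incident f u)
    second-edge e∈Γ e-u with ∈Γ⇒side e∈Γ
    ... | i , refl with incident⇒endpoint (side-joins i) e-u | next-surjective i
    ...   | inj₁ refl | j , refl =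
      side j , side∈Γ j , (λ eq → next≢ j (sym (side-injective eq))) , _ , swap (side-joins j)
    ...   | inj₂ refl | _        =
      side (next i) , side∈Γ (next i) , next≢ i ∘ side-injective , _ , side-joins (next i)

    -- Each side meets u at its start or at its end. Of three sides two do so in the same way, and
    -- these coincide since the vertices are distinct and `next` is injective.
    no-third-edge : ∀ {e f h u} → e ∈ Γ → f ∈ Γ → h ∈ Γ →
                    Incident e u → Incident f u → Incident h u → e ≢ f → f ≢ h → h ≢ e → Empty.⊥
    no-third-edge e∈Γ f∈Γ h∈Γ e-u f-u h-u e≢f f≢h h≢e
      with ∈Γ⇒side e∈Γ | ∈Γ⇒side f∈Γ | ∈Γ⇒side h∈Γ
    ... | i , refl | j , refl | l , refl
      with incident⇒endpoint (side-joins i) e-u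
         | incident⇒endpoint (side-joins j) f-u
         | incident⇒endpoint (side-joins l) h-u
    ... | inj₁ a | inj₁ b | _      = e≢f (cong side (distinct (trans (sym a) b)))
    ... | inj₁ a | inj₂ b | inj₁ c = h≢e (cong side (distinct (trans (sym c) a)))
    ... | inj₁ a | inj₂ b | inj₂ c = f≢h (cong side (next-injective (distinct (trans (sym b) c))))
    ... | inj₂ a | inj₂ b | _      = e≢f (cong side (next-injective (distinct (trans (sym a) b))))
    ... | inj₂ a | inj₁ b | inj₁ c = f≢h (cong side (distinct (trans (sym b) c)))
    ... | inj₂ a | inj₁ b | inj₂ c = h≢e (cong side (next-injective (distinct (trans (sym c) a))))

    -- Applied to a shortest cycle it gives g - 1 ≤ r, so that `coeff-fromF` reaches degree g - 1.
    ∣cycle∣≤order : ∣ Γ ∣ ≤ order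
    ∣cycle∣≤order = ℕ.≤-trans (covered⇒∣p∣≤ (3 + k) Γ side ∈Γ⇒side) (injective⇒≤ distinct)

    2≤∣cycle∣ : 2 ≤ ∣ Γ ∣
    2≤∣cycle∣ with second-edge (side∈Γ zero) (_ , side-joins zero)
    ... | f , f∈Γ , f≢0 , _ = subst (2 ≤_) (sym (x∈p⇒∣p∣≡1+∣p-x∣ (side∈Γ zero)))
      (s≤s (ℕ.≤-trans (s≤s z≤n) (ℕ.≤-reflexive (sym (x∈p⇒∣p∣≡1+∣p-x∣ (x∈p∧x≢y⇒x∈p-y f∈Γ f≢0))))))

  -- An endpoint of e has degree one in Γ ∖ e; were it not an endpoint of e′,
  -- its degree in Γ′ ∖ e′ would be zero or two.
  shared-endpoint : ∀ {Γ Γ′ e e′ u} → IsCycle G Γ → IsCycle G Γ′ → e ∈ Γ → Γ ∖ e ≡ Γ′ ∖ e′ →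
                    Incident e u → ¬ ¬ Incident e′ u
  shared-endpoint {Γ} {Γ′} {e} {e′} {u} (_ , _ , t) (_ , _ , t′) e∈Γ eq e-u ¬e′-u
    with second-edge t e∈Γ e-u
  ... | f , f∈Γ , f≢e , f-u with f∈Γ′ ← subst (f ∈_) eq (x∈p∧x≢y⇒x∈p-y f∈Γ f≢e)
    with second-edge t′ (p─q⊆p Γ′ ⁅ e′ ⁆ f∈Γ′) f-u
  ... | h , h∈Γ′ , h≢f , h-u
    -- As e′ misses u, the edge h differs from e′ and so lies in Γ ∖ e too; then e, f, h are three
    -- edges of Γ at u.
    with h∈Γ-e ← subst (h ∈_) (sym eq) (x∈p∧x≢y⇒x∈p-y h∈Γ′ λ { refl → ¬e′-u h-u })
    = no-third-edge t e∈Γ f∈Γ (p─q⊆p Γ ⁅ e ⁆ h∈Γ-e) e-u f-u h-u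
        (f≢e ∘ sym) (h≢f ∘ sym) λ { refl → x∉p-x Γ e h∈Γ-e }

  incident-both : ∀ {e u w} → u ≢ w → Incident e u → Incident e w → Joins e u w
  incident-both u≢w (x , e-ux) e-w with incident⇒endpoint e-ux e-w
  ... | inj₁ refl = contradiction refl u≢w
  ... | inj₂ refl = e-ux

  -- Both endpoints of e are endpoints of e′, so simplicity identifies the two edges. Deciding e ≟
  -- e′ first leaves a contradiction to prove, which absorbs the double negations.
  removed-edge-unique : ∀ {Γ Γ′ e e′} → IsCycle G Γ → IsCycle G Γ′ → e ∈ Γ →
                        Γ ∖ e ≡ Γ′ ∖ e′ → e ≡ e′
  removed-edge-unique {e = e} {e′} cyc cyc′ e∈Γ eq with e ≟ e′
  ... | yes e≡e′ = e≡e′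
  ... | no  e≢e′ = contradiction (λ a-e′ → shared (_ , inj₂ refl) λ b-e′ →
          e≢e′ (noMultiple (inj₁ refl) (incident-both a≢b a-e′ b-e′))) (shared (_ , inj₁ refl))
    where
    shared : ∀ {u} → Incident e u → ¬ ¬ Incident e′ u
    shared = shared-endpoint cyc cyc′ e∈Γ eq
    a≢b : proj₁ (ends e) ≢ proj₂ (ends e)
    a≢b a≡b = loopless e _ (inj₁ (cong (_, proj₂ (ends e)) a≡b))

  -- Spanning trees of a connected graph

  crossing-edge : ∀ {S : Subset order} {u w} → Star Adjacent u w → u ∈ S → w ∉ S →
                  ∃[ e ] ∃[ a ] ∃[ b ] (Joins e a b × a ∈ S × b ∉ S)
  crossing-edge ε u∈S u∉S = contradiction u∈S u∉S
  crossing-edge {S} (_◅_ {j = x} (e , e-ux) path) u∈S w∉S with x ∈? S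
  ... | yes x∈S = crossing-edge path x∈S w∉S
  ... | no  x∉S = e , _ , x , e-ux , u∈S , x∉S

  -- A tree with vertex set S and edge set T grows by one crossing edge at a time. The containment
  -- of endpoints in S shows that the crossing edge, with one end outside S, is new to T.
  subtree : Connected G → Vertex → ∀ k → suc k ≤ order →
            ∃[ S ] ∃[ T ] (∣ S ∣ ≡ suc k × ∣ T ∣ ≡ k × (∀ e → e ∈ T → ∀ {u} → Incident e u → u ∈ S))
  subtree conn root zero _ = ⁅ root ⁆ , ⊥ , ∣⁅x⁆∣≡1 root , ∣⊥∣≡0 size , λ e e∈⊥ → contradiction e∈⊥ ∉⊥
  subtree conn root (suc k) 2+k≤order with subtree conn root k (ℕ.<⇒≤ 2+k≤order)
  ... | S , T , ∣S∣ , ∣T∣ , T⊆S with nonempty? S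
  ...   | no empty = contradiction (trans (sym ∣S∣) (trans (cong ∣_∣ (Empty-unique empty)) (∣⊥∣≡0 order))) λ ()
  ...   | yes (u , u∈S) with ¬∀⟶∃¬ order (_∈ S) (_∈? S) S-proper
    where
    S-proper : ¬ (∀ x → x ∈ S)
    S-proper all = ℕ.<⇒≱ (subst (_< order) (sym ∣S∣) 2+k≤order)
      (subst (_≤ ∣ S ∣) (∣⊤∣≡n order) (p⊆q⇒∣p∣≤∣q∣ {p = ⊤} λ {x} _ → all x))
  ...     | w , w∉S with crossing-edge (conn u w) u∈S w∉S
  ...       | e , a , b , e-ab , a∈S , b∉S =
    S ∪ ⁅ b ⁆ , T ∪ ⁅ e ⁆ , trans (x∉p⇒∣p∪⁅x⁆∣≡1+∣p∣ b∉S) (cong suc ∣S∣) ,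
    trans (x∉p⇒∣p∪⁅x⁆∣≡1+∣p∣ e∉T) (cong suc ∣T∣) , T′⊆S′
    where
    e∉T : e ∉ T
    e∉T e∈T = b∉S (T⊆S e e∈T (a , swap e-ab))
    T′⊆S′ : ∀ f → f ∈ T ∪ ⁅ e ⁆ → ∀ {u} → Incident f u → u ∈ S ∪ ⁅ b ⁆
    T′⊆S′ f f∈ f-u with x∈p∪q⁻ T ⁅ e ⁆ f∈
    ... | inj₁ f∈T = p⊆p∪q ⁅ b ⁆ (T⊆S f f∈T f-u)
    ... | inj₂ f∈e with refl ← x∈⁅y⁆⇒x≡y e f∈e | incident⇒endpoint e-ab f-u
    ...   | inj₁ refl = p⊆p∪q ⁅ b ⁆ a∈S
    ...   | inj₂ refl = q⊆p∪q S ⁅ b ⁆ (x∈⁅x⁆ b)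

  -- A spanning tree has order ∸ 1 edges; the given vertex makes the order positive. The bound makes
  -- the subtraction in `cycleRank` exact.
  connected⇒order≤1+size : Connected G → Vertex → order ≤ suc size
  connected⇒order≤1+size conn root with 1+[order∸1] ← ℕ.m+[n∸m]≡n (ℕ.≤-trans (s≤s z≤n) (toℕ<n root))
    with subtree conn root (order ∸ 1) (ℕ.≤-reflexive 1+[order∸1])
  ... | _ , T , _ , ∣T∣ , _ = subst (_≤ suc size) 1+[order∸1] (s≤s (subst (_≤ size) ∣T∣ (∣p∣≤n T)))

-- Faces and girth cycles

module _ {ℓ} (G : Graph) {_≼_ : Rel (Edge G) ℓ} (≼-total : IsTotalOrder _≡_ _≼_) where
  open Graph G hiding (Edge; EdgeSet)
  private module ≼ = IsTotalOrder ≼-total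

  nonfaceCount : ℕ → ℕ
  nonfaceCount i = count (λ S → ¬? (isFace? G ≼-total S) ×-dec (∣ S ∣ ℕ.≟ i))

  faceCount+nonfaceCount : ∀ i → faceCount G ≼-total i + nonfaceCount i ≡ size C i
  faceCount+nonfaceCount i = trans (count-split (isFace? G ≼-total) (λ S → ∣ S ∣ ℕ.≟ i)) (count-size size i)

  -- This has the shape that `coeff-fromF` asks for, with the number of nonfaces as the perturbation
  -- δ.
  faceCount≡ : ∀ i → + faceCount G ≼-total i ≡ + (size C i) - + nonfaceCount i
  faceCount≡ i = begin
    + faceCount G ≼-total i
      ≡⟨ solve 2 (λ x y → x := (x :+ y) :- y) refl (+ faceCount G ≼-total i) (+ nonfaceCount i) ⟩
    + (faceCount G ≼-total i + nonfaceCount i) - + nonfaceCount i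
      ≡⟨ cong (λ x → + x - + nonfaceCount i) (faceCount+nonfaceCount i) ⟩
    + (size C i) - + nonfaceCount i ∎
    where
    open ≡-Reasoning
    open +-*-Solver

  -- A nonface is a doubly negated existence; the decidable search over subsets removes the double
  -- negation.
  nonface⇒cycle : ∀ {S} → ¬ IsFace G _≼_ S →
                  ∃[ Γ ] (IsCycle G Γ × ∃[ e ] (IsMax G _≼_ e Γ × Γ ∖ e ⊆ S))
  nonface⇒cycle {S} nonface
    with decidable-stable (anySubset? λ B → isBrokenCircuit? G ≼-total B ×-dec (B ⊆? S)) nonface
  ... | _ , (Γ , cyc , e , max , refl) , B⊆S = Γ , cyc , e , max , B⊆S

  max-edge : ∀ {Γ} → IsCycle G Γ → ∃[ e ] IsMax G _≼_ e Γ
  max-edge {Γ} (_ , _ , t) = maximum ≼.total ≼.trans Γ (side G t zero , side∈Γ G t zero)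

  BreaksTo : EdgeSet G → EdgeSet G → Set ℓ
  BreaksTo S Γ = ∃[ e ] (IsMax G _≼_ e Γ × S ≡ Γ ∖ e)

  -- The maximal edge of Γ is unique by antisymmetry.
  breaksTo-functional : ∀ {S S′ Γ} → BreaksTo S Γ → BreaksTo S′ Γ → S ≡ S′
  breaksTo-functional {Γ = Γ} (e , (e∈Γ , e-max) , refl) (f , (f∈Γ , f-max) , refl) =
    cong (Γ ∖_) (≼.antisym (f-max e e∈Γ) (e-max f f∈Γ))

  -- The removed edge is determined by `removed-edge-unique`, and putting it back recovers the
  -- cycle.
  breaksTo-injective : ∀ {S Γ Γ′} → IsCycle G Γ → IsCycle G Γ′ → BreaksTo S Γ → BreaksTo S Γ′ → Γ ≡ Γ′
  breaksTo-injective cyc cyc′ (e , (e∈Γ , _) , refl) (f , (f∈Γ′ , _) , eq)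
    with refl ← removed-edge-unique G cyc cyc′ e∈Γ eq = removal-injective e∈Γ f∈Γ′ eq

  module _ {g} (g≤∣Γ∣ : ∀ Γ → IsCycle G Γ → g ≤ ∣ Γ ∣) where

    nonface⇒g≤1+∣S∣ : ∀ {S} → ¬ IsFace G _≼_ S → g ≤ suc ∣ S ∣
    nonface⇒g≤1+∣S∣ nonface with nonface⇒cycle nonface
    ... | Γ , cyc , e , (e∈Γ , _) , Γ-e⊆S = ℕ.≤-trans (g≤∣Γ∣ Γ cyc)
      (subst (_≤ _) (sym (x∈p⇒∣p∣≡1+∣p-x∣ e∈Γ)) (s≤s (p⊆q⇒∣p∣≤∣q∣ Γ-e⊆S)))

    nonfaceCount≡0 : ∀ {i} → suc i < g → nonfaceCount i ≡ 0
    nonfaceCount≡0 {i} 1+i<g = cong length (filter-none (λ S → ¬? (isFace? G ≼-total S) ×-dec (∣ S ∣ ℕ.≟ i))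
      {subsets size} (All.tabulate λ { _ (nonface , refl) → ℕ.<⇒≱ 1+i<g (nonface⇒g≤1+∣S∣ nonface) }))

    minimal-nonface⇒cycle : ∀ {S} → ¬ IsFace G _≼_ S → suc ∣ S ∣ ≡ g →
                            ∃[ Γ ] ((IsCycle G Γ × ∣ Γ ∣ ≡ g) × BreaksTo S Γ)
    minimal-nonface⇒cycle {S} nonface 1+∣S∣≡g with nonface⇒cycle nonface
    ... | Γ , cyc , e , max@(e∈Γ , _) , Γ-e⊆S = Γ , (cyc , ∣Γ∣≡g) , e , max , sym Γ-e≡S
      where
      ∣Γ∣≡ : ∣ Γ ∣ ≡ suc ∣ Γ ∖ e ∣
      ∣Γ∣≡ = x∈p⇒∣p∣≡1+∣p-x∣ e∈Γ
      -- From 1 + ∣ S ∣ = g ≤ ∣ Γ ∣ = 1 + ∣ Γ ∖ e ∣, S has no room for an element outside Γ ∖ e.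
      Γ-e≡S : Γ ∖ e ≡ S
      Γ-e≡S = p⊆q∧∣q∣≤∣p∣⇒p≡q Γ-e⊆S (ℕ.≤-pred (ℕ.≤-trans (ℕ.≤-reflexive 1+∣S∣≡g)
                (ℕ.≤-trans (g≤∣Γ∣ Γ cyc) (ℕ.≤-reflexive ∣Γ∣≡))))
      ∣Γ∣≡g : ∣ Γ ∣ ≡ g
      ∣Γ∣≡g = trans ∣Γ∣≡ (trans (cong (suc ∘ ∣_∣) Γ-e≡S) 1+∣S∣≡g)

    -- `BreaksTo`, read in both directions, gives one inequality each way. Writing suc k ≡ g keeps
    -- truncated subtraction out.
    nonfaceCount≡cycleCount : ∀ {k} → suc k ≡ g → nonfaceCount k ≡ cycleCount G g
    nonfaceCount≡cycleCount {k} 1+k≡g = ℕ.≤-antisym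
      (count-injection nonface? cycle? BreaksTo
        (λ (nonface , ∣S∣≡k) → minimal-nonface⇒cycle nonface (trans (cong suc ∣S∣≡k) 1+k≡g))
        (λ _ _ → breaksTo-functional))
      (count-injection cycle? nonface? (λ Γ S → BreaksTo S Γ) broken
        (λ (cyc , _) (cyc′ , _) → breaksTo-injective cyc cyc′))
      where
      nonface? = λ S → ¬? (isFace? G ≼-total S) ×-dec (∣ S ∣ ℕ.≟ k)
      cycle?   = λ Γ → isCycle? G Γ ×-dec (∣ Γ ∣ ℕ.≟ g)

      broken : ∀ {Γ} → IsCycle G Γ × ∣ Γ ∣ ≡ g →
               ∃[ S ] ((¬ IsFace G _≼_ S × ∣ S ∣ ≡ k) × BreaksTo S Γ)
      broken {Γ} (cyc , ∣Γ∣≡g) with max-edge cyc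
      ... | e , max@(e∈Γ , _) = Γ ∖ e ,
        ((λ face → face (Γ ∖ e , (Γ , cyc , e , max , refl) , ⊆-refl)) ,
         ℕ.suc-injective (trans (sym (x∈p⇒∣p∣≡1+∣p-x∣ e∈Γ)) (trans ∣Γ∣≡g (sym 1+k≡g)))) ,
        e , max , refl

theorem8p1 : ∀ {ℓ : Level} (G : Graph) → Connected G →
    ∀ (g : ℕ) → IsGirth G g →
    ∀ (_≼_ : Rel (Edge G) ℓ) (≼-total : IsTotalOrder _≡_ _≼_) →
    let β = cycleRank G
        h = coeff (hPoly G ≼-total)
    in (∀ j → j ≤ g ∸ 2 → h j ≡ + ((β + j ∸ 1) C j))
     × (h (g ∸ 1) ≡ + ((β + g ∸ 2) C (g ∸ 1)) - + (cycleCount G g))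
-- A cycle has at least two edges, so g = 2 + d, and then `g ∸ 2` and `g ∸ 1` reduce to d and
-- `suc d`.
theorem8p1 G _ 0 ((_ , (_ , _ , t) , ∣Γ∣≡0) , _) _ _ =
  contradiction (subst (2 ≤_) ∣Γ∣≡0 (2≤∣cycle∣ G t)) λ ()
theorem8p1 G _ 1 ((_ , (_ , _ , t) , ∣Γ∣≡1) , _) _ _ =
  contradiction (subst (2 ≤_) ∣Γ∣≡1 (2≤∣cycle∣ G t)) λ { (s≤s ()) }
theorem8p1 G conn (suc (suc d)) ((_ , (_ , v₀ , t₀) , ∣Γ₀∣≡g) , g≤∣Γ∣) _≼_ ≼-total = low , high
  where
  open Graph G using (order; size)
  r = order ∸ 1
  β = cycleRank G
  h = coeff (hPoly G ≼-total)

  order≡1+r : order ≡ suc r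
  order≡1+r = sym (ℕ.m+[n∸m]≡n (ℕ.≤-trans (s≤s z≤n) (ℕ.≤-trans (2≤∣cycle∣ G t₀) (∣cycle∣≤order G t₀))))

  size≡β+r : size ≡ β + r
  size≡β+r = sym (trans (cong (λ n → (size + 1 ∸ n) + r) order≡1+r)
    (trans (cong (λ n → (n ∸ suc r) + r) (ℕ.+-comm size 1)) (ℕ.m∸n+n≡m r≤size)))
    where
    r≤size : r ≤ size
    r≤size = ℕ.≤-pred (subst (_≤ suc size) order≡1+r (connected⇒order≤1+size G conn (lookupᵛ v₀ zero)))

  1+d≤r : suc d ≤ r
  1+d≤r = ℕ.≤-pred (subst (2 + d ≤_) order≡1+r (subst (_≤ order) ∣Γ₀∣≡g (∣cycle∣≤order G t₀)))

  -- `coeff-fromF` is taken with k = g - 1, n = `size` and m = β; the perturbation vanishes below k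
  -- because a nonface has at least g - 1 elements.
  h≡ : ∀ j → j ≤ suc d → h j ≡ + ((β + j ∸ 1) C j) - + nonfaceCount G ≼-total j
  h≡ j j≤1+d = coeff-fromF (λ i → + faceCount G ≼-total i) (λ i → + nonfaceCount G ≼-total i) (suc d) size
    (λ i i≤d → cong +_ (nonfaceCount≡0 G ≼-total g≤∣Γ∣ (s≤s i≤d)))
    (λ i _ → faceCount≡ G ≼-total i) r β size≡β+r j (ℕ.≤-trans j≤1+d 1+d≤r) j≤1+d

  low : ∀ j → j ≤ d → h j ≡ + ((β + j ∸ 1) C j)
  low j j≤d = trans (h≡ j (ℕ.m≤n⇒m≤1+n j≤d)) (trans
    (cong (λ c → + ((β + j ∸ 1) C j) - + c) (nonfaceCount≡0 G ≼-total g≤∣Γ∣ (s≤s (s≤s j≤d))))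
    (ℤ.+-identityʳ _))

  high : h (suc d) ≡ + ((β + (2 + d) ∸ 2) C suc d) - + cycleCount G (2 + d)
  high = trans (h≡ (suc d) ℕ.≤-refl) (cong₂ (λ n c → + (n C suc d) - + c)
    -- `β + suc d ∸ 1` is definitionally `suc (β + suc d) ∸ 2`, the form in which `+-suc` applies.
    (cong (_∸ 2) (sym (ℕ.+-suc β (suc d)))) (nonfaceCount≡cycleCount G ≼-total g≤∣Γ∣ refl))
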